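{- Let $G$ be a ribbon graph, and let $\rho\in\{\delta\tau,\delta\tau\delta\}$. Then there exists a spanning quasi-tree $Q$ of $G$ such that, writing $E(Q)$ for its edge set, $$\varepsilon(G^{\rho|E(Q)})=\varepsilon_M^{\rho}(G),\qquad\text{where } \varepsilon_M^{\rho}(G)=\max_{B\subseteq E(G)}\varepsilon(G^{\rho|B}).$$
   Context: A (finite) ribbon graph $G$ with vertex set $V(G)$ and edge set $E(G)$ is a compact surface with boundary, possibly non-orientable, presented as the union of a set $V(G)$ of discs (vertices) and a set $E(G)$ of discs (edges), such that vertices and edges intersect in disjoint line segments, each such segment lies on the boundary of precisely one vertex and precisely one edge, and every edge contains exactly two such segments. If $G$ has $v$ vertices, $e$ edges, $f$ boundary components and $k$ connected components, its Euler genus is $\varepsilon(G)=2k-v+e-f$. A spanning quasi-tree of $G$ is a spanning ribbon subgraph $Q=(V(G),F)$, $F\subseteq E(G)$, whose restriction to each connected component of $G$ is connected with exactly one boundary component. Partial dual $G^{\delta|A}$, $A\subseteq E(G)$: take the boundary components of the spanning ribbon subgraph $(V(G),A)$ as curves on the surface of $G$, glue a disc to $G$ along each of these curves, and remove the interiors of all vertices of $G$; the glued discs are the vertices of $G^{\delta|A}$, and its edge set is identified with $E(G)$. Partial Petrial $G^{\tau|A}$: for each edge in $A$, detach one end of the edge from its incident vertex, give the edge a half-twist, and reattach it. Words are read left to right: $G^{\delta\tau|A}=(G^{\delta|A})^{\tau|A}$, $G^{\delta\tau\delta|A}=((G^{\delta|A})^{\tau|A})^{\delta|A}$. -}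

module Defs where

open import Algebra.Definitions using (Involutive)
open import Data.Bool.Base using (Bool; true; false; not; if_then_else_)
open import Data.Bool.Properties using (not-involutive) renaming (_≟_ to _≟ᵇ_)
open import Data.Fin.Base using (Fin)
open import Data.Fin.Properties using () renaming (_≟_ to _≟ᶠ_)
open import Data.Fin.Subset using (Subset; inside; outside; _∈_; ⊥; ⊤; ∁)
open import Data.Fin.Subset.Properties using (_∈?_)
open import Data.Integer.Base using (ℤ; +_; _-_) renaming (_+_ to _+ℤ_)
import Data.Integer.Properties as ℤ
import Data.List.Extrema ℤ.≤-totalOrder as Extrema
open import Data.List.Base using (List; []; _∷_; _++_; map; length; filter; foldl; deduplicate; cartesianProduct; allFin)
open import Data.List.Membership.Propositional using () renaming (_∈_ to _∈ˡ_)
open import Data.List.Membership.Propositional.Properties using (∈-cartesianProduct⁺; ∈-allFin; ∈-filter⁺; ∈-filter⁻)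
open import Data.List.Relation.Unary.Any using (here; there)
open import Data.Nat.Base using (ℕ; zero; suc; _+_; _*_)
open import Data.Product.Base using (_×_; _,_; uncurry; proj₂)
open import Data.Product.Properties using (≡-dec)
open import Data.Sum.Base using (_⊎_; inj₁; inj₂)
import Data.Vec.Base as Vec
open import Function.Base using (_∘_)
open import Level using (0ℓ)
import Relation.Binary.Construct.Closure.Equivalence as Eq
open Eq using (EqClosure)
open import Relation.Binary.Construct.Closure.ReflexiveTransitive using (ε; _◅_; _◅◅_)
open import Relation.Binary.Construct.Closure.Symmetric using (fwd; bwd)
open import Relation.Binary.Core using (Rel; _⇒_)
open import Relation.Binary.Definitions using (Decidable; DecidableEquality)
open import Relation.Binary.PropositionalEquality
open import Relation.Nullary using (Dec; yes; no)
open import Relation.Nullary.Decidable using (map′; _×-dec_; _⊎-dec_)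

------------------------------------------------------------------------
-- The equivalence relation generated by a decidable relation on a
-- finite set is decidable.

module _ {A : Set} (_≟_ : DecidableEquality A) where

  Listed : List (A × A) → Rel A 0ℓ
  Listed ps x y = (x , y) ∈ˡ ps

  private
    fromListed : ∀ {a b ps x y} → let _~_ = EqClosure (Listed ps) in
      x ~ y ⊎ (x ~ a × b ~ y) ⊎ (x ~ b × a ~ y) →
      EqClosure (Listed ((a , b) ∷ ps)) x y
    fromListed (inj₁ p) = Eq.map there p
    fromListed (inj₂ (inj₁ (p , q))) =
      Eq.map there p ◅◅ fwd (here refl) ◅ Eq.map there q
    fromListed (inj₂ (inj₂ (p , q))) =
      Eq.map there p ◅◅ bwd (here refl) ◅ Eq.map there q

    toListed : ∀ {a b ps x y} → let _~_ = EqClosure (Listed ps) in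
      EqClosure (Listed ((a , b) ∷ ps)) x y →
      x ~ y ⊎ (x ~ a × b ~ y) ⊎ (x ~ b × a ~ y)
    toListed ε = inj₁ ε
    toListed (fwd (there p) ◅ r) with toListed r
    ... | inj₁ u              = inj₁ (fwd p ◅ u)
    ... | inj₂ (inj₁ (u , v)) = inj₂ (inj₁ (fwd p ◅ u , v))
    ... | inj₂ (inj₂ (u , v)) = inj₂ (inj₂ (fwd p ◅ u , v))
    toListed (bwd (there p) ◅ r) with toListed r
    ... | inj₁ u              = inj₁ (bwd p ◅ u)
    ... | inj₂ (inj₁ (u , v)) = inj₂ (inj₁ (bwd p ◅ u , v))
    ... | inj₂ (inj₂ (u , v)) = inj₂ (inj₂ (bwd p ◅ u , v))
    toListed (fwd (here refl) ◅ r) with toListed r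
    ... | inj₁ u              = inj₂ (inj₁ (ε , u))
    ... | inj₂ (inj₁ (u , v)) = inj₂ (inj₁ (ε , v))
    ... | inj₂ (inj₂ (u , v)) = inj₁ v
    toListed (bwd (here refl) ◅ r) with toListed r
    ... | inj₁ u              = inj₂ (inj₂ (ε , u))
    ... | inj₂ (inj₁ (u , v)) = inj₁ v
    ... | inj₂ (inj₂ (u , v)) = inj₂ (inj₂ (ε , v))

    listed? : ∀ ps → Decidable (EqClosure (Listed ps))
    listed? [] x y = map′ (λ { refl → ε }) (λ { ε → refl ; (fwd () ◅ _) ; (bwd () ◅ _) }) (x ≟ y)
    listed? ((a , b) ∷ ps) x y = map′ fromListed toListed
      (listed? ps x y ⊎-dec
       (listed? ps x a ×-dec listed? ps b y) ⊎-dec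
       (listed? ps x b ×-dec listed? ps a y))

  eqClosure? : ∀ {R : Rel A 0ℓ} → Decidable R →
               (xs : List A) → (∀ x → x ∈ˡ xs) → Decidable (EqClosure R)
  eqClosure? {R} R? xs complete x y =
    map′ (Eq.map (proj₂ ∘ ∈-filter⁻ (uncurry R?) {xs = cartesianProduct xs xs}))
         (Eq.map (∈-filter⁺ (uncurry R?) (∈-cartesianProduct⁺ (complete _) (complete _))))
         (listed? (filter (uncurry R?) (cartesianProduct xs xs)) x y)

------------------------------------------------------------------------
-- Ribbon graphs with edge set Fin n

-- An edge disc is a rectangle: two opposite sides of its boundary are
-- the segments shared with vertices (the "ends" of the edge), and the
-- other two are free (the "long sides").  Its four corners are labelled
-- (e , i , s), where i is the end and s the long side that meet there.

Corner : ℕ → Set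
Corner n = Fin n × Bool × Bool

-- Removing the segments from the boundary circles of the vertices leaves
-- arcs, each joining two distinct corners, and circles bounding vertices
-- that carry no edges.  The perfect matching of the corners given by the
-- arcs, together with the number of isolated vertices, determines the
-- ribbon graph, and any such data arise from a ribbon graph.

record RibbonGraph (n : ℕ) : Set where
  field
    isolated       : ℕ
    arc            : Corner n → Corner n
    arc-involutive : Involutive _≡_ arc
    arc-free       : ∀ c → arc c ≢ c

open RibbonGraph

_≟ᶜ_ : ∀ {n} → DecidableEquality (Corner n)
_≟ᶜ_ = ≡-dec _≟ᶠ_ (≡-dec _≟ᵇ_ _≟ᵇ_)

corners : ∀ n → List (Corner n)
corners n = cartesianProduct (allFin n) (cartesianProduct bools bools)
  where bools = false ∷ true ∷ []

∈-corners : ∀ {n} (c : Corner n) → c ∈ˡ corners n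
∈-corners (e , i , s) =
  ∈-cartesianProduct⁺ (∈-allFin e) (∈-cartesianProduct⁺ (∈-bools i) (∈-bools s))
  where
  ∈-bools : ∀ b → b ∈ˡ (false ∷ true ∷ [])
  ∈-bools false = here refl
  ∈-bools true  = there (here refl)

-- One may move between corners along the arcs, along the ends of the
-- edges in S, and along the long sides of the edges in T.

data Step {n} (G : RibbonGraph n) (S T : Subset n) : Rel (Corner n) 0ℓ where
  along-arc  : ∀ {c} → Step G S T c (arc G c)
  along-end  : ∀ {e i s} → e ∈ S → Step G S T (e , i , s) (e , i , not s)
  along-side : ∀ {e i s} → e ∈ T → Step G S T (e , i , s) (e , not i , s)

step? : ∀ {n} (G : RibbonGraph n) S T → Decidable (Step G S T)
step? G S T x@(e , i , s) y = map′
  (λ { (inj₁ refl) → along-arc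
     ; (inj₂ (inj₁ (p , refl))) → along-end p
     ; (inj₂ (inj₂ (p , refl))) → along-side p })
  (λ { along-arc → inj₁ refl
     ; (along-end p) → inj₂ (inj₁ (p , refl))
     ; (along-side p) → inj₂ (inj₂ (p , refl)) })
  ((y ≟ᶜ arc G x) ⊎-dec
   ((e ∈? S) ×-dec (y ≟ᶜ (e , i , not s))) ⊎-dec
   ((e ∈? T) ×-dec (y ≟ᶜ (e , not i , s))))

Linked : ∀ {n} → RibbonGraph n → (S T : Subset n) → Rel (Corner n) 0ℓ
Linked G S T = EqClosure (Step G S T)

linked? : ∀ {n} (G : RibbonGraph n) S T → Decidable (Linked G S T)
linked? {n} G S T = eqClosure? _≟ᶜ_ (step? G S T) (corners n) ∈-corners

SameVertex : ∀ {n} → RibbonGraph n → Rel (Corner n) 0ℓ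
SameVertex G = Linked G ⊤ ⊥

-- The following two concern the spanning ribbon subgraph (V(G), A).  Its
-- boundary follows the long sides of an edge in A, and runs along the
-- ends of an edge that is not in A.

SameComponent : ∀ {n} → RibbonGraph n → Subset n → Rel (Corner n) 0ℓ
SameComponent G A = Linked G ⊤ A

SameBoundary : ∀ {n} → RibbonGraph n → Subset n → Rel (Corner n) 0ℓ
SameBoundary G A = Linked G (∁ A) A

classes : ∀ {n} (R : Rel (Corner n) 0ℓ) → Decidable R → ℕ
classes {n} R R? = length (deduplicate R? (corners n))

-- An isolated vertex is also a component and has one boundary circle.

#vertices #components #boundaries : ∀ {n} → RibbonGraph n → ℕ
#vertices   G = isolated G + classes (SameVertex G) (linked? G ⊤ ⊥)
#components G = isolated G + classes (SameComponent G ⊤) (linked? G ⊤ ⊤)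
#boundaries G = isolated G + classes (SameBoundary G ⊤) (linked? G (∁ ⊤) ⊤)

eulerGenus : ∀ {n} → RibbonGraph n → ℤ
eulerGenus {n} G =
  + (2 * #components G) - + #vertices G +ℤ + n - + #boundaries G

-- Every component of G that is not an isolated vertex contains a corner,
-- as does every vertex and every boundary component of (V(G), F) in it, so
-- both conditions may be tested on pairs of corners of one component of G.
-- On isolated vertices they hold automatically.

record IsSpanningQuasiTree {n} (G : RibbonGraph n) (F : Subset n) : Set where
  field
    connected   : SameComponent G ⊤ ⇒ SameComponent G F
    oneBoundary : SameComponent G ⊤ ⇒ SameBoundary G F

------------------------------------------------------------------------
-- Partial duals and partial Petrials

relabel : ∀ {n} (f : Corner n → Corner n) → Involutive _≡_ f →
          RibbonGraph n → RibbonGraph n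
relabel f inv G = record
  { isolated       = isolated G
  ; arc            = f ∘ arc G ∘ f
  ; arc-involutive = λ c → trans (cong (f ∘ arc G) (inv _))
                             (trans (cong f (arc-involutive G _)) (inv c))
  ; arc-free       = λ c p → arc-free G (f c) (trans (sym (inv _)) (cong f p))
  }

on : ∀ {n} → Subset n → (Bool × Bool → Bool × Bool) → Corner n → Corner n
on A g (e , is) = e , (if Vec.lookup A e then g is else is)

on-involutive : ∀ {n} (A : Subset n) {g} → Involutive _≡_ g →
                Involutive _≡_ (on A g)
on-involutive A inv (e , is) with Vec.lookup A e
... | true  = cong (e ,_) (inv is)
... | false = refl

exchange twist : Bool × Bool → Bool × Bool
exchange (i , s) = s , i
twist (false , s) = false , s
twist (true  , s) = true , not s

exchange-involutive : Involutive _≡_ exchange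
exchange-involutive _ = refl

twist-involutive : Involutive _≡_ twist
twist-involutive (false , s) = refl
twist-involutive (true  , s) = cong (true ,_) (not-involutive s)

-- The new vertices are bounded by the boundary components of (V(G), A).
-- These contain all the arcs, the ends of the edges outside A and the long
-- sides of the edges in A; so each edge in A is now attached along what
-- were its long sides, i.e. its ends and long sides are exchanged.

partialDual : ∀ {n} → RibbonGraph n → Subset n → RibbonGraph n
partialDual G A = relabel (on A exchange) (on-involutive A exchange-involutive) G

-- The end `true` of each edge in A is reattached with its two corners
-- interchanged.

partialPetrial : ∀ {n} → RibbonGraph n → Subset n → RibbonGraph n
partialPetrial G A = relabel (on A twist) (on-involutive A twist-involutive) G

data Operation : Set where
  δ τ : Operation

apply : ∀ {n} → Subset n → RibbonGraph n → Operation → RibbonGraph n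
apply A G δ = partialDual G A
apply A G τ = partialPetrial G A

-- G ^ ρ ∣ A, the word ρ being read from left to right.

infix 8 _^_∣_

_^_∣_ : ∀ {n} → RibbonGraph n → List Operation → Subset n → RibbonGraph n
G ^ ρ ∣ A = foldl (apply A) G ρ

δτ δτδ : List Operation
δτ  = δ ∷ τ ∷ []
δτδ = δ ∷ τ ∷ δ ∷ []

subsets : ∀ n → List (Subset n)
subsets zero    = Vec.[] ∷ []
subsets (suc n) = map (outside Vec.∷_) (subsets n) ++ map (inside Vec.∷_) (subsets n)

-- The first argument of `max` is only the default for the empty list; it
-- is itself one of the values over which the maximum is taken.

maxEulerGenus : ∀ {n} → List Operation → RibbonGraph n → ℤ
maxEulerGenus {n} ρ G =
  Extrema.max (eulerGenus (G ^ ρ ∣ ⊥)) (map (λ B → eulerGenus (G ^ ρ ∣ B)) (subsets n))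

{-# OPTIONS --safe #-}
module Submission where

-- Let each edge prescribe one of three ways to continue from its corners:
-- along its end, along its long side, or diagonally.  Following arcs and
-- turns decomposes the corners into circles.  Vertices, boundary components
-- and their counterparts in G ^ ρ ∣ A are all circles of G for suitable turns,
-- so up to constants - ε is
--     c(side on A, end off A) + c(diag on A, side off A)  for δτ,
--     c(diag on A, end off A)                             for δτδ,
-- and A is a quasi-tree iff all four corners of each edge lie on one circle for
-- the turns T = (side on A, end off A).  If they do not at e, then toggling e
-- in A lowers c(T) by one; any toggle changes any of these counts by at most 1.
--
-- For δτ, toggling such edges therefore never increases the cost.  For δτδ,
-- suppose that every such toggle raises the cost.  Two circles of different
-- systems of turns have an even number of corners in common.  Apply this to a
-- fixed circle of T meeting e once and to a circle of the turns obtained by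
-- toggling e: it yields a second edge, in A, that they cross.  Starting from an
-- e in A (which is found by the same argument), toggling both edges does not
-- raise the cost or c(T), and removes two edges from A.

open import Defs
open import Algebra.Definitions using (Involutive)
open import Data.Bool.Base using (Bool; true; false; not; _∧_; _xor_; if_then_else_)
open import Data.Bool.Properties
  using (not-involutive; not-injective; not-distribˡ-xor; not-distribʳ-xor; xor-assoc;
         xor-identityʳ; xor-same; ¬-not; not-¬)
  renaming (_≟_ to _≟ᵇ_)
open import Data.Bool.Solver using (module xor-∧-Solver)
open import Data.Fin.Base using (Fin; zero; suc) renaming (_<_ to _<ᶠ_)
open import Data.Fin.Properties using (pigeonhole; any?; all?; ¬∀⟶∃¬) renaming (_≟_ to _≟ᶠ_)
open import Data.Fin.Subset using (Subset; ⊤; ⊥; ∁; ∣_∣) renaming (_∈_ to _∈ˢ_)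
open import Data.Fin.Subset.Properties using (_∈?_; ∈⊤; ∉⊥; x∈∁p⇒x∉p; x∉p⇒x∈∁p)
open import Data.List.Base
  using (List; []; _∷_; _++_; map; length; lookup; filter; foldr; deduplicate;
         cartesianProduct; allFin)
open import Data.List.Membership.Propositional using (_∈_)
open import Data.List.Membership.Propositional.Properties
  using (∈-lookup; ∈-allFin; ∈-++⁺ˡ; ∈-++⁺ʳ; ∈-map⁺; ∈-map⁻)
open import Data.List.Properties using (length-map; filter-all)
open import Data.List.Relation.Unary.All using (All; []; _∷_)
import Data.List.Relation.Unary.All as All
import Data.List.Relation.Unary.All.Properties as All
open import Data.List.Relation.Unary.AllPairs using (AllPairs; []; _∷_)
import Data.List.Relation.Unary.AllPairs as AllPairs
import Data.List.Relation.Unary.AllPairs.Properties as AllPairs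
open import Data.List.Relation.Unary.Any using (Any; here; there; index)
import Data.List.Relation.Unary.Any as Any
import Data.List.Relation.Unary.Any.Properties as Any
open import Data.List.Relation.Unary.Unique.DecSetoid.Properties using (deduplicate-!)
open import Data.List.Relation.Unary.Unique.Propositional using (Unique)
open import Data.List.Relation.Unary.Unique.Propositional.Properties
  using (cartesianProduct⁺; allFin⁺)
open import Data.Nat.Base using (ℕ; zero; suc; _+_; _*_; _≤_; _<_; z≤n; s≤s; s<s)
open import Data.Nat.Properties
open import Data.Nat.Induction using (<-wellFounded; Acc; acc)
open import Data.Integer.Base as ℤ using (ℤ)
import Data.Integer.Properties as ℤ
open import Data.Integer.Solver using () renaming (module +-*-Solver to ℤ-Solver)
import Data.List.Extrema ℤ.≤-totalOrder as Extrema
open import Data.Product.Base using (∃; _×_; _,_; proj₁; proj₂; swap)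
open import Data.Sum.Base as Sum using (_⊎_; inj₁; inj₂)
import Data.Vec.Base as Vec
open import Data.Vec.Properties using (lookup∘updateAt; lookup∘updateAt′; []=⇒lookup; lookup⇒[]=)
open import Function.Base using (_∘_; id; case_of_)
open import Function.Bundles using (mk⇔)
open import Relation.Binary.Core using (Rel; _⇒_)
open import Relation.Binary.Definitions using (Decidable; DecidableEquality)
open import Relation.Binary.Structures using (IsEquivalence)
open import Relation.Binary.PropositionalEquality
import Relation.Binary.Construct.Closure.Equivalence as Eq
open Eq using (EqClosure)
open import Relation.Binary.Construct.Closure.ReflexiveTransitive using (ε; _◅◅_)
open import Relation.Nullary using (Dec; yes; no; ¬_; does; contradiction)
open import Relation.Nullary.Decidable
  using (dec-true; does-⇔; dec-false; map′; _×-dec_; _⊎-dec_; ¬?)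
open import Level using (0ℓ)

private
  variable
    A : Set
    n : ℕ

AllPairs-lookup : ∀ {R : Rel A 0ℓ} {xs} → AllPairs R xs →
                  ∀ {i j} → i <ᶠ j → R (lookup xs i) (lookup xs j)
AllPairs-lookup (rs ∷ _)  {zero}  {suc j} _         = All.lookup rs (∈-lookup j)
AllPairs-lookup (_ ∷ prs) {suc i} {suc j} (s<s i<j) = AllPairs-lookup prs i<j

-- Counting classes

module _ {n} {R : Rel (Corner n) 0ℓ} (equiv : IsEquivalence R) (R? : Decidable R) where
  private
    module R = IsEquivalence equiv

    cover : ∀ c → Any (R c) (deduplicate R? (corners n))
    cover c = Any.deduplicate⁺ R? (λ zy cy → R.trans cy (R.sym zy))
                (Any.map (λ { refl → R.refl }) (∈-corners c))

  representatives-apart : AllPairs (λ x y → ¬ R x y) (deduplicate R? (corners n))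
  representatives-apart = deduplicate-!
    (record { isDecEquivalence = record { isEquivalence = equiv ; _≟_ = R? } }) (corners n)

  -- Pigeonhole: in a longer list two members would share a representative and so be related.
  apart⇒≤classes : ∀ {zs} → AllPairs (λ x y → ¬ R x y) zs → length zs ≤ classes R R?
  apart⇒≤classes {zs} apart = ≮⇒≥ λ lt →
    let (i , j , i<j , eq) = pigeonhole lt (index ∘ cover ∘ lookup zs)
        r-i = Any.lookup-index (cover (lookup zs i))
        r-j = Any.lookup-index (cover (lookup zs j))
    in AllPairs-lookup apart i<j
         (R.trans r-i (R.sym (subst (λ k → R (lookup zs j) (lookup (deduplicate R? (corners n)) k)) (sym eq) r-j)))

  -- Two members related to `v` would be related to each other, so the filter removes at most one.
  apart⇒≤suc-filter : ∀ v {xs} → AllPairs (λ x y → ¬ R x y) xs →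
                      length xs ≤ suc (length (filter (λ x → ¬? (R? x v)) xs))
  apart⇒≤suc-filter v []                      = z≤n
  apart⇒≤suc-filter v {x ∷ xs} (¬xs ∷ apart) with R? x v
  ... | no  _  = s≤s (apart⇒≤suc-filter v apart)
  ... | yes xv = s≤s (≤-reflexive (cong length (sym (filter-all (λ x → ¬? (R? x v))
                   (All.map (λ ¬xy yv → ¬xy (R.trans xv (R.sym yv))) ¬xs)))))

module _ {n} {R R′ : Rel (Corner n) 0ℓ}
         (equiv : IsEquivalence R) (equiv′ : IsEquivalence R′)
         (R? : Decidable R) (R′? : Decidable R′) where
  private
    module R  = IsEquivalence equiv
    module R′ = IsEquivalence equiv′
    reps  = deduplicate R? (corners n)
    reps′ = deduplicate R′? (corners n)

  -- The images under `h` of representatives for `R` are apart for `R′`. Below, `h` is the identity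
  -- or a relabelling of corners.
  classes-≤ : ∀ h → (∀ {x y} → R′ (h x) (h y) → R x y) → classes R R? ≤ classes R′ R′?
  classes-≤ h reflects = subst (_≤ classes R′ R′?) (length-map h reps)
    (apart⇒≤classes equiv′ R′?
      (AllPairs.map⁺ (AllPairs.map (_∘ reflects) (representatives-apart equiv R?))))

  -- At most one member of the list lies in the `R′`-class of `u` and `v`, and it cannot be
  -- `R`-related to both.
  misses-one : R ⇒ R′ → ∀ {u v} → R′ u v → ¬ R u v →
               ∀ {xs} → AllPairs (λ x y → ¬ R′ x y) xs →
               All (λ x → ¬ R u x) xs ⊎ All (λ x → ¬ R v x) xs
  misses-one R⊆R′ uv′ ¬uv [] = inj₁ []
  misses-one R⊆R′ {u} {v} uv′ ¬uv {x ∷ _} (¬xs ∷ apart) with R? u x | R? v x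
  ... | yes ux | _      = inj₂ ((λ vx → ¬uv (R.trans ux (R.sym vx)))
    ∷ All.map (λ ¬xy vy → ¬xy (R′.trans (R⊆R′ (R.sym ux)) (R′.trans uv′ (R⊆R′ vy)))) ¬xs)
  ... | no ¬ux | yes vx = inj₁ (¬ux
    ∷ All.map (λ ¬xy uy → ¬xy (R′.trans (R⊆R′ (R.sym vx)) (R′.trans (R′.sym uv′) (R⊆R′ uy)))) ¬xs)
  ... | no ¬ux | no ¬vx = Sum.map (¬ux ∷_) (¬vx ∷_) (misses-one R⊆R′ uv′ ¬uv apart)

  -- Representatives for `R′` are apart for the finer `R` too, and by `misses-one` either `u` or `v`
  -- can be added to them.
  classes-< : R ⇒ R′ → ∀ {u v} → R′ u v → ¬ R u v → classes R′ R′? < classes R R?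
  classes-< R⊆R′ uv′ ¬uv = Sum.[ extend , extend ]
    (misses-one R⊆R′ uv′ ¬uv (representatives-apart equiv′ R′?))
    where
    extend : ∀ {w} → All (λ x → ¬ R w x) reps′ → classes R′ R′? < classes R R?
    extend ¬ws = apart⇒≤classes equiv R?
      (¬ws ∷ AllPairs.map (_∘ R⊆R′) (representatives-apart equiv′ R′?))

  -- Without the representative of the class of `v`, the representatives for `R` are apart for `R′`
  -- as well.
  classes-≤-suc : ∀ v → (∀ {x y} → R′ x y → ¬ R x v → ¬ R y v → R x y) →
                  classes R R? ≤ suc (classes R′ R′?)
  classes-≤-suc v reflects = ≤-trans (apart⇒≤suc-filter equiv R? v apart)
    (s≤s (apart⇒≤classes equiv′ R′? (apart′ apart)))
    where
    apart = representatives-apart equiv R?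
    ≁v? = λ x → ¬? (R? x v)

    apart′ : ∀ {xs} → AllPairs (λ x y → ¬ R x y) xs →
             AllPairs (λ x y → ¬ R′ x y) (filter ≁v? xs)
    apart′ []                     = []
    apart′ {x ∷ xs} (¬xs ∷ apart) with R? x v
    ... | yes _  = apart′ apart
    ... | no ¬xv = All.zipWith (λ (¬xy , ¬yv) xy′ → ¬xy (reflects xy′ ¬xv ¬yv))
                     (All.filter⁺ ≁v? ¬xs , All.all-filter ≁v? xs) ∷ apart′ apart

classes-≡ : ∀ {R R′ : Rel (Corner n) 0ℓ} → IsEquivalence R → IsEquivalence R′ →
            (R? : Decidable R) (R′? : Decidable R′) → R ⇒ R′ → R′ ⇒ R →
            classes R R? ≡ classes R′ R′?
classes-≡ equiv equiv′ R? R′? to from = ≤-antisym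
  (classes-≤ equiv equiv′ R? R′? id from) (classes-≤ equiv′ equiv R′? R? id to)

does-class : ∀ {n} {R : Rel (Corner n) 0ℓ} → IsEquivalence R → (R? : Decidable R) →
             ∀ x {y z} → R y z → does (R? x z) ≡ does (R? x y)
does-class equiv R? x {y} {z} yz =
  does-⇔ (mk⇔ (λ xz → trans′ xz (sym′ yz)) (λ xy → trans′ xy yz)) (R? x z) (R? x y)
  where open IsEquivalence equiv renaming (sym to sym′; trans to trans′)

-- Parity

⨁ : List A → (A → Bool) → Bool
⨁ []       h = false
⨁ (x ∷ xs) h = h x xor ⨁ xs h

module _ {A : Set} where

  ⨁-cong : ∀ {h k : A → Bool} → h ≗ k → ∀ xs → ⨁ xs h ≡ ⨁ xs k
  ⨁-cong h≗k []       = refl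
  ⨁-cong h≗k (x ∷ xs) = cong₂ _xor_ (h≗k x) (⨁-cong h≗k xs)

  ⨁-distrib-xor : ∀ (h k : A → Bool) xs → ⨁ xs (λ x → h x xor k x) ≡ ⨁ xs h xor ⨁ xs k
  ⨁-distrib-xor h k []       = refl
  ⨁-distrib-xor h k (x ∷ xs) = trans (cong ((h x xor k x) xor_) (⨁-distrib-xor h k xs))
    (solve 4 (λ a b c d → (a :+ b) :+ (c :+ d) := (a :+ c) :+ (b :+ d)) refl
       (h x) (k x) (⨁ xs h) (⨁ xs k))
    where open xor-∧-Solver

  ⨁-++ : ∀ (h : A → Bool) xs ys → ⨁ (xs ++ ys) h ≡ ⨁ xs h xor ⨁ ys h
  ⨁-++ h []       ys = refl
  ⨁-++ h (x ∷ xs) ys = trans (cong (h x xor_) (⨁-++ h xs ys))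
                         (sym (xor-assoc (h x) (⨁ xs h) (⨁ ys h)))

  ⨁-map : ∀ {B : Set} (h : A → Bool) (f : B → A) xs → ⨁ (map f xs) h ≡ ⨁ xs (h ∘ f)
  ⨁-map h f []       = refl
  ⨁-map h f (x ∷ xs) = cong (h (f x) xor_) (⨁-map h f xs)

  ⨁-zero : ∀ {h : A → Bool} {xs} → All (λ x → h x ≡ false) xs → ⨁ xs h ≡ false
  ⨁-zero []         = refl
  ⨁-zero (eq ∷ eqs) = cong₂ _xor_ eq (⨁-zero eqs)

  ⨁-single : ∀ (h : A → Bool) {a xs} → Unique xs → a ∈ xs →
             (∀ {x} → x ≢ a → h x ≡ false) → ⨁ xs h ≡ h a
  ⨁-single h {a} (a∉ ∷ _) (here refl) others =
    trans (cong (h a xor_) (⨁-zero (All.map (others ∘ ≢-sym) a∉))) (xor-identityʳ (h a))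
  ⨁-single h (x∉ ∷ uniq) (there a∈) others =
    cong₂ _xor_ (others (All.lookup x∉ a∈)) (⨁-single h uniq a∈ others)

  -- Induction peels off the first row and the first column; by symmetry their sums `r` are equal
  -- and cancel.
  ⨁-symmetric : ∀ (m : A → A → Bool) → (∀ x y → m x y ≡ m y x) → (∀ x → m x x ≡ false) →
                ∀ xs → ⨁ xs (λ x → ⨁ xs (m x)) ≡ false
  ⨁-symmetric m symm diag []       = refl
  ⨁-symmetric m symm diag (x ∷ xs) = begin
    (m x x xor r) xor ⨁ xs (λ y → m y x xor ⨁ xs (m y))
      ≡⟨ cong₂ _xor_ (cong (_xor r) (diag x)) (⨁-distrib-xor (λ y → m y x) _ xs) ⟩
    r xor (⨁ xs (λ y → m y x) xor ⨁ xs (λ y → ⨁ xs (m y)))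
      ≡⟨ cong (r xor_) (cong₂ _xor_ (⨁-cong (λ y → symm y x) xs) (⨁-symmetric m symm diag xs)) ⟩
    r xor (r xor false)
      ≡⟨ cong (r xor_) (xor-identityʳ r) ⟩
    r xor r
      ≡⟨ xor-same r ⟩
    false ∎
    where
    open ≡-Reasoning
    r = ⨁ xs (m x)

⨁-cartesianProduct : ∀ {A B : Set} (h : A × B → Bool) xs ys →
  ⨁ (cartesianProduct xs ys) h ≡ ⨁ xs (λ x → ⨁ ys (λ y → h (x , y)))
⨁-cartesianProduct h []       ys = refl
⨁-cartesianProduct h (x ∷ xs) ys =
  trans (⨁-++ h (map (x ,_) ys) (cartesianProduct xs ys))
        (cong₂ _xor_ (⨁-map h (x ,_) ys) (⨁-cartesianProduct h xs ys))

bools : List Bool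
bools = false ∷ true ∷ []

positions : List (Bool × Bool)
positions = cartesianProduct bools bools

positions-unique : Unique positions
positions-unique = cartesianProduct⁺ bools! bools!
  where
  bools! : Unique bools
  bools! = ((λ ()) ∷ []) ∷ [] ∷ []

∈-positions : ∀ u → u ∈ positions
∈-positions (false , false) = here refl
∈-positions (false , true)  = there (here refl)
∈-positions (true  , false) = there (there (here refl))
∈-positions (true  , true)  = there (there (there (here refl)))

corners-unique : ∀ n → Unique (corners n)
corners-unique n = cartesianProduct⁺ (allFin⁺ n) positions-unique

module _ {n} (G : RibbonGraph n) where
  open RibbonGraph G

  -- Write h c as the sum over all c′ of h c [c′ = arc c]: a symmetric
  -- matrix with zero diagonal.
  ⨁-arc-invariant : ∀ (h : Corner n → Bool) → (∀ c → h (arc c) ≡ h c) → ⨁ (corners n) h ≡ false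
  ⨁-arc-invariant h inv = trans (⨁-cong (sym ∘ row) (corners n))
                                (⨁-symmetric m m-sym m-diag (corners n))
    where
    m : Corner n → Corner n → Bool
    m c c′ = does (c′ ≟ᶜ arc c) ∧ h c

    m-diag : ∀ c → m c c ≡ false
    m-diag c = cong (_∧ h c) (dec-false (c ≟ᶜ arc c) (arc-free c ∘ sym))

    m-sym : ∀ c c′ → m c c′ ≡ m c′ c
    m-sym c c′ with c′ ≟ᶜ arc c | c ≟ᶜ arc c′
    ... | yes refl | yes _  = sym (inv c)
    ... | yes refl | no ¬p  = contradiction (sym (arc-involutive c)) ¬p
    ... | no ¬p | yes refl  = contradiction (sym (arc-involutive c′)) ¬p
    ... | no _  | no _      = refl

    row : ∀ c → ⨁ (corners n) (m c) ≡ h c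
    row c = trans (⨁-single (m c) (corners-unique n) (∈-corners (arc c))
                    (λ {c′} ne → cong (_∧ h c) (dec-false (c′ ≟ᶜ arc c) ne)))
                  (cong (_∧ h c) (dec-true (arc c ≟ᶜ arc c) refl))

  ⨁-edges : ∀ (h : Corner n → Bool) → (∀ c → h (arc c) ≡ h c) →
            ⨁ (allFin n) (λ e → ⨁ positions (λ u → h (e , u))) ≡ false
  ⨁-edges h inv = trans (sym (⨁-cartesianProduct h (allFin n) positions)) (⨁-arc-invariant h inv)

  -- By `⨁-edges` the contributions of all edges sum to zero, so `e` is not the only odd one.
  odd-edges-paired : ∀ (h : Corner n → Bool) → (∀ c → h (arc c) ≡ h c) →
    ∀ e → ⨁ positions (λ u → h (e , u)) ≡ true →
    ∃ λ f → f ≢ e × ⨁ positions (λ u → h (f , u)) ≡ true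
  odd-edges-paired h inv e odd
    with any? (λ f → ¬? (f ≟ᶠ e) ×-dec (⨁ positions (λ u → h (f , u)) ≟ᵇ true))
  ... | yes found = found
  ... | no  none  = contradiction (trans (sym (⨁-edges h inv)) (trans single odd)) λ ()
    where
    single = ⨁-single (λ f → ⨁ positions (λ u → h (f , u))) (allFin⁺ n) (∈-allFin e)
               (λ f≢e → ¬-not λ t → none (_ , f≢e , t))

-- Turns

-- A boundary walk reaching a corner of an edge continues along the end of
-- the edge, along its long side, or diagonally across it.
data Turn : Set where
  end side diag : Turn

_≟ᵗ_ : DecidableEquality Turn
end  ≟ᵗ end  = yes refl
end  ≟ᵗ side = no λ ()
end  ≟ᵗ diag = no λ ()
side ≟ᵗ end  = no λ ()
side ≟ᵗ side = yes refl
side ≟ᵗ diag = no λ ()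
diag ≟ᵗ end  = no λ ()
diag ≟ᵗ side = no λ ()
diag ≟ᵗ diag = yes refl

flip : Turn → Bool × Bool → Bool × Bool
flip end  (i , s) = i , not s
flip side (i , s) = not i , s
flip diag (i , s) = not i , not s

-- `flip t` groups the four positions into two pairs; `half t` tells them apart.
half : Turn → Bool × Bool → Bool
half end  (i , s) = i
half side (i , s) = s
half diag (i , s) = i xor s

half-flip-≢ : ∀ {t t′} → t ≢ t′ → ∀ u → half t (flip t′ u) ≡ not (half t u)
half-flip-≢ {end}  {end}  ne u = contradiction refl ne
half-flip-≢ {end}  {side} ne u = refl
half-flip-≢ {end}  {diag} ne u = refl
half-flip-≢ {side} {end}  ne u = refl
half-flip-≢ {side} {side} ne u = contradiction refl ne
half-flip-≢ {side} {diag} ne u = refl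
half-flip-≢ {diag} {end}  ne (i , s) = sym (not-distribʳ-xor i s)
half-flip-≢ {diag} {side} ne (i , s) = sym (not-distribˡ-xor i s)
half-flip-≢ {diag} {diag} ne u = contradiction refl ne

half-≡ : ∀ t u w → half t u ≡ half t w → w ≡ u ⊎ w ≡ flip t u
half-≡ end  (i , s) (.i , s′) refl with s′ ≟ᵇ s
... | yes refl = inj₁ refl
... | no  ne    = inj₂ (cong (i ,_) (¬-not ne))
half-≡ side (i , s) (i′ , .s) refl with i′ ≟ᵇ i
... | yes refl = inj₁ refl
... | no  ne    = inj₂ (cong (_, s) (¬-not ne))
half-≡ diag (false , s) (false , s′) eq = inj₁ (cong (false ,_) (sym eq))
half-≡ diag (false , s) (true , s′)  eq = inj₂ (cong (true ,_) (trans (sym (not-involutive s′)) (cong not (sym eq))))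
half-≡ diag (true , s) (false , s′)  eq = inj₂ (cong (false ,_) (sym eq))
half-≡ diag (true , s) (true , s′)   eq = inj₁ (cong (true ,_) (not-injective (sym eq)))

-- A position in the pair of `t` that does not contain `(false , false)`; see `half-far`.
far : Turn → Bool × Bool
far end  = true , false
far side = false , true
far diag = true , false

-- An invariant `p` is constant on each of the two pairs, so one value from each determines it.
factor-half : ∀ t (p : Bool × Bool → Bool) → (∀ u → p (flip t u) ≡ p u) →
              ∀ u → p u ≡ (if half t u then p (far t) else p (false , false))
factor-half t    p inv (false , false) = cong (λ b → if b then p (far t) else p (false , false)) (sym (half-origin t))
  where
  half-origin : ∀ t → half t (false , false) ≡ false
  half-origin end  = refl
  half-origin side = refl
  half-origin diag = refl
factor-half end  p inv (false , true)  = inv (false , false)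
factor-half end  p inv (true  , false) = refl
factor-half end  p inv (true  , true)  = inv (true , false)
factor-half side p inv (false , true)  = refl
factor-half side p inv (true  , false) = inv (false , false)
factor-half side p inv (true  , true)  = inv (false , true)
factor-half diag p inv (false , true)  = inv (true , false)
factor-half diag p inv (true  , false) = refl
factor-half diag p inv (true  , true)  = inv (false , false)

-- Each pair contributes the same value twice.
⨁-flip-invariant : ∀ t (p : Bool × Bool → Bool) → (∀ u → p (flip t u) ≡ p u) →
                   ⨁ positions p ≡ false
⨁-flip-invariant t p inv = trans (⨁-cong (factor-half t p inv) positions) (balanced t _ _)
  where
  open xor-∧-Solver
  balanced : ∀ t a b → ⨁ positions (λ u → if half t u then b else a) ≡ false
  balanced end  = solve 2 (λ a b → a :+ (a :+ (b :+ (b :+ con false))) := con false) refl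
  balanced side = solve 2 (λ a b → a :+ (b :+ (a :+ (b :+ con false))) := con false) refl
  balanced diag = solve 2 (λ a b → a :+ (b :+ (b :+ (a :+ con false))) := con false) refl

-- Two turns split the four positions into pairs transversally, so exactly
-- one position lies in a prescribed pair of each.
⨁-transversal : ∀ {t t′} → t ≢ t′ → ∀ {p q : Bool × Bool → Bool} →
  (∀ u → p (flip t u) ≡ p u) → (∀ u → q (flip t′ u) ≡ q u) →
  p (far t) ≢ p (false , false) → q (far t′) ≢ q (false , false) →
  ⨁ positions (λ u → p u ∧ q u) ≡ true
⨁-transversal {t} {t′} t≢t′ {p} {q} p-inv q-inv p≢ q≢ = trans
  (⨁-cong (λ u → cong₂ _∧_ (split t p p-inv p≢ u) (split t′ q q-inv q≢ u)) positions)
  (count t≢t′ _ _)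
  where
  split : ∀ t p → (∀ u → p (flip t u) ≡ p u) → p (far t) ≢ p (false , false) →
          ∀ u → p u ≡ half t u xor p (false , false)
  split t p inv ne u = trans (factor-half t p inv u)
    (trans (cong (λ b → if half t u then b else p (false , false)) (¬-not ne)) (if-xor (half t u)))
    where
    if-xor : ∀ b {x} → (if b then not x else x) ≡ b xor x
    if-xor false = refl
    if-xor true  = refl

  table : ∀ {P : Bool → Bool → Set} → P false false → P false true → P true false → P true true →
          ∀ a b → P a b
  table ff ft tf tt false false = ff
  table ff ft tf tt false true  = ft
  table ff ft tf tt true  false = tf
  table ff ft tf tt true  true  = tt

  count : ∀ {t t′} → t ≢ t′ → ∀ a b →
          ⨁ positions (λ u → (half t u xor a) ∧ (half t′ u xor b)) ≡ true
  count {end}  {end}  ne = contradiction refl ne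
  count {end}  {side} _ = table refl refl refl refl
  count {end}  {diag} _ = table refl refl refl refl
  count {side} {end}  _ = table refl refl refl refl
  count {side} {side} ne = contradiction refl ne
  count {side} {diag} _ = table refl refl refl refl
  count {diag} {end}  _ = table refl refl refl refl
  count {diag} {side} _ = table refl refl refl refl
  count {diag} {diag} ne = contradiction refl ne

-- Circles

data Walk {n} (G : RibbonGraph n) (T : Fin n → Turn) : Rel (Corner n) 0ℓ where
  along-arc : ∀ {c} → Walk G T c (RibbonGraph.arc G c)
  turn      : ∀ {e u} → Walk G T (e , u) (e , flip (T e) u)

walk? : ∀ {n} (G : RibbonGraph n) T → Decidable (Walk G T)
walk? G T x@(e , u) y = map′
  (λ { (inj₁ refl) → along-arc ; (inj₂ refl) → turn })
  (λ { along-arc → inj₁ refl ; turn → inj₂ refl })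
  ((y ≟ᶜ RibbonGraph.arc G x) ⊎-dec (y ≟ᶜ (e , flip (T e) u)))

Circle : ∀ {n} → RibbonGraph n → (Fin n → Turn) → Rel (Corner n) 0ℓ
Circle G T = EqClosure (Walk G T)

circle? : ∀ {n} (G : RibbonGraph n) T → Decidable (Circle G T)
circle? {n} G T = eqClosure? _≟ᶜ_ (walk? G T) (corners n) ∈-corners

#circles : ∀ {n} → RibbonGraph n → (Fin n → Turn) → ℕ
#circles G T = classes (Circle G T) (circle? G T)

circle-isEquivalence : ∀ {n} (G : RibbonGraph n) T → IsEquivalence (Circle G T)
circle-isEquivalence G T = Eq.isEquivalence (Walk G T)

Joined : ∀ {n} → RibbonGraph n → (Fin n → Turn) → Fin n → Set
Joined G T e = ∀ u w → Circle G T (e , u) (e , w)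

step : ∀ {R : Rel A 0ℓ} {x y} → R x y → EqClosure R x y
step = Eq.return

reverse : ∀ {R : Rel A 0ℓ} {x y} → EqClosure R x y → EqClosure R y x
reverse = Eq.symmetric _

-- The turn at `e` already links positions of equal half, so a single link across the halves
-- suffices.
joined : ∀ (G : RibbonGraph n) T {e u w} → half (T e) u ≢ half (T e) w →
         Circle G T (e , u) (e , w) → Joined G T e
joined G T {e} {u} {w} ne uw x y = reverse (toU x) ◅◅ toU y
  where
  toU : ∀ x → Circle G T (e , u) (e , x)
  toU x with half (T e) x ≟ᵇ half (T e) u
  ... | yes eq with half-≡ (T e) u x (sym eq)
  ...   | inj₁ refl = ε
  ...   | inj₂ refl = step turn
  toU x | no ne′ with half-≡ (T e) w x (trans (¬-not (≢-sym ne)) (sym (¬-not ne′)))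
  ...   | inj₁ refl = uw
  ...   | inj₂ refl = uw ◅◅ step turn

half-far : ∀ t → half t (false , false) ≢ half t (far t)
half-far end  ()
half-far side ()
half-far diag ()

joined? : ∀ (G : RibbonGraph n) T e → Dec (Joined G T e)
joined? G T e = map′ (joined G T (half-far (T e))) (λ J → J _ _)
                     (circle? G T (e , false , false) (e , far (T e)))

-- Changing the turn at a single edge

Adjacent : (T T′ : Fin n → Turn) → Fin n → Set
Adjacent T T′ e = (∀ f → f ≢ e → T f ≡ T′ f) × T e ≢ T′ e

Adjacent-sym : ∀ {T T′ : Fin n → Turn} {e} → Adjacent T T′ e → Adjacent T′ T e
Adjacent-sym (same , differ) = (λ f f≢e → sym (same f f≢e)) , ≢-sym differ

module _ {n} (G : RibbonGraph n) {T T′ : Fin n → Turn} {e} (adj : Adjacent T T′ e) where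
  private
    same   = proj₁ adj
    differ = proj₂ adj

  -- Only at `e` can a walk for `T` make a turn that `T′` lacks, and there `J` replaces it.
  joined⇒⊆ : Joined G T′ e → Circle G T ⇒ Circle G T′
  joined⇒⊆ J = Eq.fold (circle-isEquivalence G T′) λ
    { along-arc → step along-arc ; (turn {f}) → via f }
    where
    via : ∀ f {u} → Circle G T′ (f , u) (f , flip (T f) u)
    via f {u} with f ≟ᶠ e
    ... | yes refl = J _ _
    ... | no  f≢e  = step (subst (λ t → Walk G T′ (f , u) (f , flip t u)) (sym (same f f≢e)) turn)

  joined⇒≤ : Joined G T′ e → #circles G T′ ≤ #circles G T
  joined⇒≤ J = classes-≤ (circle-isEquivalence G T′) (circle-isEquivalence G T) _ _ id (joined⇒⊆ J)

  private
    -- The circles cut open at `e`. Strands use only turns common to `T` and `T′`, so they are parts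
    -- of circles of both.
    data Strand : Rel (Corner n) 0ℓ where
      along-arc : ∀ {c} → Strand c (RibbonGraph.arc G c)
      turn      : ∀ {f u} → f ≢ e → Strand (f , u) (f , flip (T f) u)

    strand? : Decidable Strand
    strand? x@(f , u) y = map′
      (λ { (inj₁ refl) → along-arc ; (inj₂ (f≢e , refl)) → turn f≢e })
      (λ { along-arc → inj₁ refl ; (turn f≢e) → inj₂ (f≢e , refl) })
      ((y ≟ᶜ RibbonGraph.arc G x) ⊎-dec (¬? (f ≟ᶠ e) ×-dec (y ≟ᶜ (f , flip (T f) u))))

    strand⇒circle : EqClosure Strand ⇒ Circle G T
    strand⇒circle = Eq.map λ { along-arc → along-arc ; (turn _) → turn }

    strand⇒circle′ : EqClosure Strand ⇒ Circle G T′
    strand⇒circle′ = Eq.map λ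
      { along-arc → along-arc
      ; (turn {f} {u} f≢e) → subst (λ t → Walk G T′ (f , u) (f , flip t u)) (sym (same f f≢e)) turn }

    closed? : Decidable (EqClosure Strand)
    closed? = eqClosure? _≟ᶜ_ strand? (corners n) ∈-corners

    -- The component of (e , u) under Strand meets every other edge in an even
    -- number of corners, hence e as well.
    strand-returns : ¬ Joined G T e → ∀ u → EqClosure Strand (e , u) (e , flip (T e) u)
    strand-returns ¬J u with closed? (e , u) (e , flip (T e) u)
    ... | yes p = p
    ... | no ¬p = contradiction odd even
      where
      h : Corner n → Bool
      h c = does (closed? (e , u) c)

      h-cong : ∀ {x y} → Strand x y → h y ≡ h x
      h-cong = does-class (Eq.isEquivalence Strand) closed? (e , u) ∘ step

      alone : ∀ {w} → w ≢ u → ¬ EqClosure Strand (e , u) (e , w)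
      alone {w} w≢u uw with half (T e) u ≟ᵇ half (T e) w
      ... | no ne = ¬J (joined G T ne (strand⇒circle uw))
      ... | yes eq with half-≡ (T e) u w eq
      ...   | inj₁ w≡u  = w≢u w≡u
      ...   | inj₂ refl = ¬p uw

      odd : ∃ λ f → f ≢ e × ⨁ positions (λ w → h (f , w)) ≡ true
      odd = odd-edges-paired G h (λ c → h-cong along-arc) e
        (trans (⨁-single (λ w → h (e , w)) positions-unique (∈-positions u)
                 (λ w≢u → dec-false (closed? _ _) (alone w≢u)))
               (dec-true (closed? (e , u) (e , u)) ε))

      even : ¬ (∃ λ f → f ≢ e × ⨁ positions (λ w → h (f , w)) ≡ true)
      even (f , f≢e , eq) with trans (sym eq)
        (⨁-flip-invariant (T f) (λ w → h (f , w)) (λ w → h-cong (turn f≢e)))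
      ... | ()

  -- The strand leaving a corner of `e` returns at its partner under `T e`. Since `T′ e` is a
  -- different turn, that partner lies in the other half of `T′ e`.
  ¬joined⇒joined′ : ¬ Joined G T e → Joined G T′ e
  ¬joined⇒joined′ ¬J = joined G T′ {u = false , false}
    (λ eq → not-¬ refl (trans eq (half-flip-≢ (≢-sym differ) (false , false))))
    (strand⇒circle′ (strand-returns ¬J (false , false)))

  -- Two distinct circles of `T` pass `e`, and they become one for `T′`.
  ¬joined⇒< : ¬ Joined G T e → #circles G T′ < #circles G T
  ¬joined⇒< ¬J = classes-< (circle-isEquivalence G T) (circle-isEquivalence G T′) _ _
    (joined⇒⊆ J′) (J′ (false , false) (far (T e))) (¬J ∘ joined G T (half-far (T e)))
    where J′ = ¬joined⇒joined′ ¬J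

  private
    Meets : Corner n → Set
    Meets x = ∃ λ u → Circle G T x (e , u)

    -- All circles of `T` through `e` fused into one class. This contains every circle of `T′`,
    -- whichever turn `T′` makes at `e`.
    Merged : Rel (Corner n) 0ℓ
    Merged x y = Circle G T x y ⊎ Meets x × Meets y

    merged-isEquivalence : IsEquivalence Merged
    merged-isEquivalence = record
      { refl  = inj₁ ε
      ; sym   = Sum.map reverse swap
      ; trans = λ
        { (inj₁ xy)       (inj₁ yz)             → inj₁ (xy ◅◅ yz)
        ; (inj₁ xy)       (inj₂ ((u , yu) , mz)) → inj₂ ((u , xy ◅◅ yu) , mz)
        ; (inj₂ (mx , u , yu)) (inj₁ yz)         → inj₂ (mx , u , reverse yz ◅◅ yu)
        ; (inj₂ (mx , _)) (inj₂ (_ , mz))       → inj₂ (mx , mz) }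
      }

    circle′⇒merged : Circle G T′ ⇒ Merged
    circle′⇒merged = Eq.fold merged-isEquivalence λ
      { along-arc → inj₁ (step along-arc) ; (turn {f}) → via f }
      where
      via : ∀ f {u} → Merged (f , u) (f , flip (T′ f) u)
      via f {u} with f ≟ᶠ e
      ... | yes refl = inj₂ ((_ , ε) , (_ , ε))
      ... | no  f≢e  = inj₁ (step (subst (λ t → Walk G T (f , u) (f , flip t u)) (same f f≢e) turn))

    -- At most two circles pass `e`, one through each pair of `T e`.
    far-or-near : ∀ {x} → Meets x → ¬ Circle G T x (e , far (T e)) → Circle G T x (e , false , false)
    far-or-near (u , xu) ¬far with half (T e) u ≟ᵇ half (T e) (far (T e))
    ... | yes eq with half-≡ (T e) u (far (T e)) eq
    ...   | inj₁ refl = contradiction xu ¬far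
    ...   | inj₂ eq′  = contradiction (xu ◅◅ subst (λ w → Circle G T (e , u) (e , w)) (sym eq′) (step turn)) ¬far
    far-or-near (u , xu) ¬far | no ne
      with half-≡ (T e) u (false , false) (trans (¬-not ne) (sym (¬-not (half-far (T e)))))
    ...   | inj₁ refl = xu
    ...   | inj₂ eq′  = xu ◅◅ subst (λ w → Circle G T (e , u) (e , w)) (sym eq′) (step turn)

  #circles-≤-suc : #circles G T ≤ suc (#circles G T′)
  #circles-≤-suc = classes-≤-suc (circle-isEquivalence G T) (circle-isEquivalence G T′) _ _
    -- With the circle through the far pair discarded, only one circle through `e` can remain, so
    -- fusing identifies nothing new.
    (e , far (T e)) λ xy′ ¬x ¬y → case circle′⇒merged xy′ of λ
      { (inj₁ xy) → xy
      ; (inj₂ (mx , my)) → far-or-near mx ¬x ◅◅ reverse (far-or-near my ¬y) }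

  >⇒¬joined : #circles G T < #circles G T′ → ¬ Joined G T′ e
  >⇒¬joined lt J′ = <⇒≱ lt (joined⇒≤ J′)

-- Crossings of two circles

module _ {n} (G : RibbonGraph n) where

  on-circle : (T : Fin n → Turn) → Corner n → Corner n → Bool
  on-circle T c x = does (circle? G T c x)

  on-circle-cong : ∀ T c {x y} → Circle G T x y → on-circle T c y ≡ on-circle T c x
  on-circle-cong T = does-class (circle-isEquivalence G T) (circle? G T)

  -- The circle through c passes e exactly once.
  Once : (T : Fin n → Turn) → Corner n → Fin n → Set
  Once T c e = on-circle T c (e , far (T e)) ≢ on-circle T c (e , false , false)

  once⇒¬joined : ∀ {T c e} → Once T c e → ¬ Joined G T e
  once⇒¬joined {T} {c} once J = once (on-circle-cong T c (J _ _))

  ¬joined⇒once : ∀ {T e} → ¬ Joined G T e → Once T (e , false , false) e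
  ¬joined⇒once {T} {e} ¬J eq
    with trans (sym (dec-false (circle? G T _ _) (¬J ∘ joined G T (half-far (T e)))))
               (trans eq (dec-true (circle? G T (e , false , false) _) ε))
  ... | ()

  -- The corners common to two circles are permuted by the arcs, so their
  -- number is even.  An edge contributes an odd number of them exactly when
  -- both circles pass it once, in different ways.
  crossings-paired : ∀ {T T′ c c′ e} → T e ≢ T′ e → Once T c e → Once T′ c′ e →
                     ∃ λ f → f ≢ e × T f ≢ T′ f × Once T c f × Once T′ c′ f
  crossings-paired {T} {T′} {c} {c′} {e} T≢T′ once once′ =
    let (f , f≢e , odd) = odd-edges-paired G both both-arc e
                            (⨁-transversal T≢T′ (inv T c e) (inv T′ c′ e) once once′)
    in f , f≢e
     , (λ eq → even (T f) (λ u → cong₂ _∧_ (inv T c f u)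
                  (subst (λ t → on-circle T′ c′ (f , flip t u) ≡ on-circle T′ c′ (f , u)) (sym eq) (inv T′ c′ f u))) odd)
     , (λ eq → even (T′ f) (λ u → cong₂ _∧_ (constant T c f eq u) (inv T′ c′ f u)) odd)
     , (λ eq → even (T f) (λ u → cong₂ _∧_ (inv T c f u) (constant T′ c′ f eq u)) odd)
    where
    both : Corner n → Bool
    both x = on-circle T c x ∧ on-circle T′ c′ x

    both-arc : ∀ x → both (RibbonGraph.arc G x) ≡ both x
    both-arc x = cong₂ _∧_ (on-circle-cong T c (step along-arc)) (on-circle-cong T′ c′ (step along-arc))

    inv : ∀ T c f u → on-circle T c (f , flip (T f) u) ≡ on-circle T c (f , u)
    inv T c f u = on-circle-cong T c (step turn)

    constant : ∀ T c f → on-circle T c (f , far (T f)) ≡ on-circle T c (f , false , false) →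
               ∀ {w} u → on-circle T c (f , w) ≡ on-circle T c (f , u)
    constant T c f eq {w} u = trans (at w) (sym (at u))
      where
      at : ∀ u → on-circle T c (f , u) ≡ on-circle T c (f , false , false)
      at u with half (T f) u | factor-half (T f) (λ u → on-circle T c (f , u)) (inv T c f) u
      ... | false | p≡ = p≡
      ... | true  | p≡ = trans p≡ eq

    even : ∀ {f} t → (∀ u → both (f , flip t u) ≡ both (f , u)) →
           ⨁ positions (λ u → both (f , u)) ≢ true
    even t inv eq with trans (sym eq) (⨁-flip-invariant t _ inv)
    ... | ()

-- Toggling an edge

choose : Turn → Turn → Subset n → Fin n → Turn
choose s t A e = if Vec.lookup A e then s else t

toggle : Subset n → Fin n → Subset n
toggle A e = Vec.updateAt A e not

lookup-toggle-≢ : ∀ (A : Subset n) {e f} → f ≢ e → Vec.lookup (toggle A e) f ≡ Vec.lookup A f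
lookup-toggle-≢ A {e} {f} f≢e = lookup∘updateAt′ f e f≢e A

choose-toggle : ∀ {s t} (A : Subset n) e → choose s t (toggle A e) e ≡ choose t s A e
choose-toggle {s = s} {t} A e with Vec.lookup A e | lookup∘updateAt e {not} A
... | false | eq = cong (λ b → if b then s else t) eq
... | true  | eq = cong (λ b → if b then s else t) eq

choose-toggle-≢ : ∀ {s t} (A : Subset n) {e f} → f ≢ e → choose s t (toggle A e) f ≡ choose s t A f
choose-toggle-≢ {s = s} {t} A f≢e = cong (λ b → if b then s else t) (lookup-toggle-≢ A f≢e)

choose-≢ : ∀ {s t s′ t′} → s ≢ s′ → t ≢ t′ → ∀ (A : Subset n) e → choose s t A e ≢ choose s′ t′ A e
choose-≢ s≢ t≢ A e with Vec.lookup A e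
... | false = t≢
... | true  = s≢

toggle-adjacent : ∀ {s t} → s ≢ t → ∀ (A : Subset n) e →
                  Adjacent (choose s t A) (choose s t (toggle A e)) e
toggle-adjacent s≢t A e =
    (λ f f≢e → sym (choose-toggle-≢ A f≢e))
  , (λ eq → choose-≢ s≢t (≢-sym s≢t) A e (trans eq (choose-toggle A e)))

∣toggle-inside∣ : ∀ (A : Subset n) e → Vec.lookup A e ≡ true → suc ∣ toggle A e ∣ ≡ ∣ A ∣
∣toggle-inside∣ (true  Vec.∷ A) zero    eq = refl
∣toggle-inside∣ (true  Vec.∷ A) (suc e) eq = cong suc (∣toggle-inside∣ A e eq)
∣toggle-inside∣ (false Vec.∷ A) (suc e) eq = ∣toggle-inside∣ A e eq

∣toggle∣≤ : ∀ (A : Subset n) e → ∣ toggle A e ∣ ≤ suc ∣ A ∣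
∣toggle∣≤ (true  Vec.∷ A) zero    = m≤n+m ∣ A ∣ 2
∣toggle∣≤ (false Vec.∷ A) zero    = ≤-refl
∣toggle∣≤ (true  Vec.∷ A) (suc e) = s≤s (∣toggle∣≤ A e)
∣toggle∣≤ (false Vec.∷ A) (suc e) = ∣toggle∣≤ A e

-- Well-founded induction on `μ`; `cost` need only not increase at each step.
descend : (P : Subset n → Set) (μ cost : Subset n → ℕ) →
          (∀ A → P A ⊎ ∃ λ A′ → μ A′ < μ A × cost A′ ≤ cost A) →
          ∀ A → ∃ λ Q → P Q × cost Q ≤ cost A
descend P μ cost improve A = go A (<-wellFounded (μ A))
  where
  go : ∀ A → Acc _<_ (μ A) → ∃ λ Q → P Q × cost Q ≤ cost A
  go A (acc rec) with improve A
  ... | inj₁ p = A , p , ≤-refl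
  ... | inj₂ (A′ , lt , le) with go A′ (rec lt)
  ...   | Q , q , le′ = Q , q , ≤-trans le′ le

-- Improving a set of edges until it is a quasi-tree

module _ {n} (G : RibbonGraph n) where

  #choose : Turn → Turn → Subset n → ℕ
  #choose s t A = #circles G (choose s t A)

  Quasi : Subset n → Set
  Quasi A = ∀ e → Joined G (choose side end A) e

  quasi? : ∀ A → Quasi A ⊎ ∃ λ e → ¬ Joined G (choose side end A) e
  quasi? A with all? (joined? G (choose side end A))
  ... | yes q = inj₁ q
  ... | no ¬q = inj₂ (¬∀⟶∃¬ n _ (joined? G (choose side end A)) ¬q)

  -- Toggling an edge that is not joined lowers the first summand by at least one and raises the
  -- second by at most one.
  improve-δτ : ∀ A → Quasi A ⊎ ∃ λ A′ → #choose side end A′ < #choose side end A ×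
    #choose side end A′ + #choose diag side A′ ≤ #choose side end A + #choose diag side A
  improve-δτ A = Sum.map₂ (λ (e , ¬J) → toggle A e , drop ¬J , bound ¬J) (quasi? A)
    where
    drop : ∀ {e} → ¬ Joined G (choose side end A) e →
           #choose side end (toggle A e) < #choose side end A
    drop {e} = ¬joined⇒< G (toggle-adjacent (λ ()) A e)

    bound : ∀ {e} → ¬ Joined G (choose side end A) e →
            #choose side end (toggle A e) + #choose diag side (toggle A e)
              ≤ #choose side end A + #choose diag side A
    bound {e} ¬J = begin
      a′ + #choose diag side (toggle A e)
        ≤⟨ +-monoʳ-≤ a′ (#circles-≤-suc G (Adjacent-sym (toggle-adjacent (λ ()) A e))) ⟩
      a′ + suc (#choose diag side A)
        ≡⟨ +-suc a′ _ ⟩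
      suc a′ + #choose diag side A
        ≤⟨ +-monoˡ-≤ _ (drop ¬J) ⟩
      #choose side end A + #choose diag side A ∎
      where
      open ≤-Reasoning
      a′ = #choose side end (toggle A e)

  -- The factor 2 makes the loss of one circle outweigh the possible gain of one edge. If the number
  -- of circles does not grow, a smaller set is lighter.
  weight : Subset n → ℕ
  weight A = 2 * #choose side end A + ∣ A ∣

  improve-δτδ : ∀ A → Quasi A ⊎ ∃ λ A′ → weight A′ < weight A × #choose diag end A′ ≤ #choose diag end A
  improve-δτδ A with quasi? A
  ... | inj₁ q = inj₁ q
  ... | inj₂ (e₀ , ¬J₀)
    with any? (λ e → ¬? (joined? G (choose side end A) e) ×-dec
                     (#choose diag end (toggle A e) ≤? #choose diag end A))
  ... | yes (e , ¬J , le) = inj₂ (toggle A e , lighter , le)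
    where
    open ≤-Reasoning
    a  = #choose side end A
    a′ = #choose side end (toggle A e)
    lighter : weight (toggle A e) < weight A
    lighter = begin-strict
      2 * a′ + ∣ toggle A e ∣   ≤⟨ +-monoʳ-≤ (2 * a′) (∣toggle∣≤ A e) ⟩
      2 * a′ + suc ∣ A ∣        ≡⟨ +-suc (2 * a′) ∣ A ∣ ⟩
      1 + 2 * a′ + ∣ A ∣        <⟨ n<1+n _ ⟩
      2 + 2 * a′ + ∣ A ∣        ≡⟨ cong (_+ ∣ A ∣) (*-suc 2 a′) ⟨
      2 * suc a′ + ∣ A ∣        ≤⟨ +-monoˡ-≤ ∣ A ∣ (*-monoʳ-≤ 2 (¬joined⇒< G (toggle-adjacent (λ ()) A e) ¬J)) ⟩
      2 * a + ∣ A ∣ ∎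
  ... | no none = inj₂ (A₂ , lighter , cheaper)
    where
    T = choose side end A
    -- The circle of `T` through `c` is kept fixed from here on. It passes `e₀` exactly once because
    -- `e₀` is not joined.
    c = e₀ , false , false

    costlier : ∀ {e} → ¬ Joined G T e → #choose diag end A < #choose diag end (toggle A e)
    costlier ¬J = ≰⇒> λ le → none (_ , ¬J , le)

    -- On `A` the two turns at `e` are `side` and `end`, off `A` they are `end` and `diag`.
    turns-≢ : ∀ e → T e ≢ choose diag end (toggle A e) e
    turns-≢ e eq = choose-≢ (λ ()) (λ ()) A e (trans eq (choose-toggle A e))

    -- Toggling e splits the circle of choose diag end A through e, and one of
    -- the two new circles must cross the fixed circle through c again.
    advance : ∀ {e} → Once G T c e →
              ∃ λ f → f ≢ e × Vec.lookup A f ≡ true × Once G T c f ×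
                      ¬ Joined G (choose diag end (toggle A e)) f
    advance {e} once =
      let ¬J = once⇒¬joined G once
          (f , f≢e , T≢ , once-f , once′-f) = crossings-paired G (turns-≢ e) once
            (¬joined⇒once G (>⇒¬joined G (toggle-adjacent (λ ()) A e) (costlier ¬J)))
      in f , f≢e , inside f (λ eq → T≢ (trans eq (sym (choose-toggle-≢ A f≢e)))) , once-f , once⇒¬joined G once′-f
      where
      -- Off `A` both systems choose `end`, so they can differ only on `A`.
      inside : ∀ f → T f ≢ choose diag end A f → Vec.lookup A f ≡ true
      inside f ne with Vec.lookup A f
      ... | true  = refl
      ... | false = contradiction refl ne

    -- Since `e₀` may lie outside `A`, it only serves to find `g` in `A` on the same circle;
    -- starting again from `g` gives `h`, also in `A`.
    first = advance (¬joined⇒once G ¬J₀)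
    g = proj₁ first
    g∈A = proj₁ (proj₂ (proj₂ first))
    once-g = proj₁ (proj₂ (proj₂ (proj₂ first)))

    second = advance once-g
    h = proj₁ second
    h≢g = proj₁ (proj₂ second)
    h∈A = proj₁ (proj₂ (proj₂ second))
    ¬joined-h = proj₂ (proj₂ (proj₂ (proj₂ second)))

    A₁ = toggle A g
    A₂ = toggle A₁ h

    cheaper : #choose diag end A₂ ≤ #choose diag end A
    -- Toggling `g` adds at most one circle. Then `h` is not joined, so toggling it removes at least
    -- one.
    cheaper = ≤-pred (≤-trans (¬joined⇒< G (toggle-adjacent (λ ()) A₁ h) ¬joined-h)
                              (#circles-≤-suc G (Adjacent-sym (toggle-adjacent (λ ()) A g))))

    lighter : weight A₂ < weight A
    lighter = +-mono-≤-< (*-monoʳ-≤ 2 circles-≤) size-<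
      where
      circles-≤ : #choose side end A₂ ≤ #choose side end A
      -- Here the roles are reversed: toggling `g` removes at least one circle of `T`, and toggling
      -- `h` adds at most one back.
      circles-≤ = ≤-trans (#circles-≤-suc G (Adjacent-sym (toggle-adjacent (λ ()) A₁ h)))
                          (¬joined⇒< G (toggle-adjacent (λ ()) A g) (once⇒¬joined G once-g))

      size-< : ∣ A₂ ∣ < ∣ A ∣
      -- As `h` differs from `g`, it is still present after `g` has been removed.
      size-< = ≤-trans (≤-reflexive (∣toggle-inside∣ A₁ h (trans (lookup-toggle-≢ A h≢g) h∈A)))
                       (≤-trans (n≤1+n _) (≤-reflexive (∣toggle-inside∣ A g g∈A)))

-- Ribbon graph invariants as numbers of circles

module _ {n} (G : RibbonGraph n) {S R : Subset n} {T : Fin n → Turn} where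

  linked⇒circle : (∀ {e} → e ∈ˢ S → T e ≡ end) → (∀ {e} → e ∈ˢ R → T e ≡ side) →
                  Linked G S R ⇒ Circle G T
  linked⇒circle ends sides = Eq.map λ
    { along-arc      → along-arc
    ; (along-end {e} {i} {s} p)  → subst (λ t → Walk G T (e , i , s) (e , flip t (i , s))) (ends p) turn
    ; (along-side {e} {i} {s} p) → subst (λ t → Walk G T (e , i , s) (e , flip t (i , s))) (sides p) turn }

  circle⇒linked : (∀ e → (T e ≡ end × e ∈ˢ S) ⊎ (T e ≡ side × e ∈ˢ R)) →
                  Circle G T ⇒ Linked G S R
  circle⇒linked turns = Eq.map λ { along-arc → along-arc ; (turn {e}) → via (turns e) }
    where
    via : ∀ {e u} → (T e ≡ end × e ∈ˢ S) ⊎ (T e ≡ side × e ∈ˢ R) →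
          Step G S R (e , u) (e , flip (T e) u)
    via (inj₁ (eq , p)) rewrite eq = along-end p
    via (inj₂ (eq , p)) rewrite eq = along-side p

module _ {n} (G : RibbonGraph n) where

  #circles-cong : ∀ {T T′} → T ≗ T′ → #circles G T ≡ #circles G T′
  #circles-cong {T} {T′} eq = classes-≡ (circle-isEquivalence G T) (circle-isEquivalence G T′) _ _
    (Eq.map (walk eq)) (Eq.map (walk (sym ∘ eq)))
    where
    walk : ∀ {T T′} → T ≗ T′ → Walk G T ⇒ Walk G T′
    walk eq along-arc  = along-arc
    walk {T′ = T′} eq (turn {e} {u}) = subst (λ t → Walk G T′ (e , u) (e , flip t u)) (sym (eq e)) turn

  #vertices-circles : #vertices G ≡ RibbonGraph.isolated G + #circles G (λ _ → end)
  #vertices-circles = cong (RibbonGraph.isolated G +_)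
    (classes-≡ (Eq.isEquivalence _) (circle-isEquivalence G _) _ _
      (linked⇒circle G (λ _ → refl) (λ p → contradiction p ∉⊥))
      (circle⇒linked G (λ _ → inj₁ (refl , ∈⊤))))

  #boundaries-circles : #boundaries G ≡ RibbonGraph.isolated G + #circles G (λ _ → side)
  #boundaries-circles = cong (RibbonGraph.isolated G +_)
    (classes-≡ (Eq.isEquivalence _) (circle-isEquivalence G _) _ _
      (linked⇒circle G (λ p → contradiction ∈⊤ (x∈∁p⇒x∉p p)) (λ _ → refl))
      (circle⇒linked G (λ _ → inj₂ (refl , ∈⊤))))

  edge-linked : ∀ e u w → SameComponent G ⊤ (e , u) (e , w)
  edge-linked e u w = reverse (origin u) ◅◅ origin w
    where
    origin : ∀ u → SameComponent G ⊤ (e , false , false) (e , u)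
    origin (false , false) = ε
    origin (false , true)  = step (along-end ∈⊤)
    origin (true  , false) = step (along-side ∈⊤)
    origin (true  , true)  = step (along-end ∈⊤) ◅◅ step (along-side ∈⊤)

  quasi⇒quasiTree : ∀ {A} → Quasi G A → IsSpanningQuasiTree G A
  quasi⇒quasiTree {A} joined = record
    { connected   = Eq.map (λ { along-arc → along-arc ; (along-end _) → along-end ∈⊤
                              ; (along-side p) → along-side p }) ∘ oneBoundary
    ; oneBoundary = oneBoundary }
    where
    turns : ∀ e → (choose side end A e ≡ end × e ∈ˢ ∁ A) ⊎ (choose side end A e ≡ side × e ∈ˢ A)
    turns e with e ∈? A
    ... | yes p rewrite []=⇒lookup p = inj₂ (refl , p)
    ... | no ¬p rewrite ¬-not {Vec.lookup A e} {true} (¬p ∘ lookup⇒[]= e A) = inj₁ (refl , x∉p⇒x∈∁p ¬p)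

    oneBoundary : SameComponent G ⊤ ⇒ SameBoundary G A
    -- A step other than an arc stays on one edge, and all corners of that edge lie on one circle.
    oneBoundary = circle⇒linked G turns ∘ Eq.fold (circle-isEquivalence G _) λ
      { along-arc → step along-arc ; (along-end {e} _) → joined e _ _ ; (along-side {e} _) → joined e _ _ }

-- Relabelling

module _ {n} (G : RibbonGraph n) (A : Subset n) (g : Bool × Bool → Bool × Bool)
         (g-inv : Involutive _≡_ g) where
  private
    f     = on A g
    f-inv = on-involutive A {g} g-inv
    G′    = relabel f f-inv G

  relabel-arc : ∀ c → f (RibbonGraph.arc G c) ≡ RibbonGraph.arc G′ (f c)
  relabel-arc c = cong (f ∘ RibbonGraph.arc G) (sym (f-inv c))

  relabel-arc′ : ∀ c → f (RibbonGraph.arc G′ c) ≡ RibbonGraph.arc G (f c)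
  relabel-arc′ c = f-inv _

  classes-relabel : ∀ {R R′ : Rel (Corner n) 0ℓ} → IsEquivalence R → IsEquivalence R′ →
                    (R? : Decidable R) (R′? : Decidable R′) →
                    (∀ {x y} → R x y → R′ (f x) (f y)) → (∀ {x y} → R′ x y → R (f x) (f y)) →
                    classes R′ R′? ≡ classes R R?
  classes-relabel {R} {R′} equiv equiv′ R? R′? to from = ≤-antisym
    (classes-≤ equiv′ equiv R′? R? f λ {x} {y} p → subst₂ R′ (f-inv x) (f-inv y) (to p))
    (classes-≤ equiv equiv′ R? R′? f λ {x} {y} p → subst₂ R (f-inv x) (f-inv y) (from p))

  -- The relabelling moves corners only within their edge, and `edge-linked` holds for every edge.
  #components-relabel : #components G′ ≡ #components G
  #components-relabel = cong (RibbonGraph.isolated G +_)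
    (classes-relabel (Eq.isEquivalence _) (Eq.isEquivalence _) (linked? G ⊤ ⊤) (linked? G′ ⊤ ⊤)
      (Eq.gfold (Eq.isEquivalence _) f λ
        { (along-arc {c}) → subst (SameComponent G′ ⊤ (f c)) (sym (relabel-arc c)) (step along-arc)
        ; (along-end _) → edge-linked G′ _ _ _ ; (along-side _) → edge-linked G′ _ _ _ })
      (Eq.gfold (Eq.isEquivalence _) f λ
        { (along-arc {c}) → subst (SameComponent G ⊤ (f c)) (sym (relabel-arc′ c)) (step along-arc)
        ; (along-end _) → edge-linked G _ _ _ ; (along-side _) → edge-linked G _ _ _ }))

  module _ (σ : Turn → Turn) (g-flip : ∀ t u → g (flip t u) ≡ flip (σ t) (g u)) where

    relabelTurns : (Fin n → Turn) → Fin n → Turn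
    relabelTurns T e = if Vec.lookup A e then σ (T e) else T e

    on-flip : ∀ T e u → f (e , flip (T e) u) ≡ (e , flip (relabelTurns T e) (proj₂ (f (e , u))))
    on-flip T e u with Vec.lookup A e
    ... | false = refl
    ... | true  = cong (e ,_) (g-flip (T e) u)

    -- By `on-flip` the relabelling carries walks to walks, and being an involution it carries them
    -- back.
    #circles-relabel : ∀ T → #circles G′ T ≡ #circles G (relabelTurns T)
    #circles-relabel T = classes-relabel
      (circle-isEquivalence G (relabelTurns T)) (circle-isEquivalence G′ T)
      (circle? G (relabelTurns T)) (circle? G′ T)
      (Eq.gmap f λ
        { (along-arc {c}) → subst (Walk G′ T (f c)) (sym (relabel-arc c)) along-arc
        ; (turn {e} {u}) → subst (Walk G′ T (f (e , u))) (back e u) turn })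
      (Eq.gmap f λ
        { (along-arc {c}) → subst (Walk G (relabelTurns T) (f c)) (sym (relabel-arc′ c)) along-arc
        ; (turn {e} {u}) → subst (Walk G (relabelTurns T) (f (e , u))) (sym (on-flip T e u)) turn })
      where
      back : ∀ e u → (e , flip (T e) (proj₂ (f (e , u)))) ≡ f (e , flip (relabelTurns T e) u)
      back e u = trans (sym (f-inv _)) (cong f (trans (on-flip T e (proj₂ (f (e , u))))
        (cong (λ w → e , flip (relabelTurns T e) (proj₂ w)) (f-inv (e , u)))))

dualTurn petrialTurn : Turn → Turn
dualTurn end  = side
dualTurn side = end
dualTurn diag = diag
petrialTurn end  = end
petrialTurn side = diag
petrialTurn diag = side

exchange-flip : ∀ t u → exchange (flip t u) ≡ flip (dualTurn t) (exchange u)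
exchange-flip end  u = refl
exchange-flip side u = refl
exchange-flip diag u = refl

twist-flip : ∀ t u → twist (flip t u) ≡ flip (petrialTurn t) (twist u)
twist-flip end  (false , s) = refl
twist-flip end  (true  , s) = refl
twist-flip side (false , s) = refl
twist-flip side (true  , s) = cong (false ,_) (sym (not-involutive s))
twist-flip diag (false , s) = cong (true ,_) (not-involutive s)
twist-flip diag (true  , s) = refl

turnOf : Operation → Turn → Turn
turnOf δ = dualTurn
turnOf τ = petrialTurn

module _ {n} (A : Subset n) where

  apply-components : ∀ G o → #components (apply A G o) ≡ #components G
  apply-components G δ = #components-relabel G A exchange exchange-involutive
  apply-components G τ = #components-relabel G A twist twist-involutive

  apply-isolated : ∀ G o → RibbonGraph.isolated (apply A G o) ≡ RibbonGraph.isolated G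
  apply-isolated G δ = refl
  apply-isolated G τ = refl

  apply-choose : ∀ G o s t → #choose (apply A G o) s t A ≡ #choose G (turnOf o s) t A
  apply-choose G o s t = trans (relabelled G o) (#circles-cong G chosen)
    where
    turns : Fin n → Turn
    turns e = if Vec.lookup A e then turnOf o (choose s t A e) else choose s t A e

    relabelled : ∀ G o → #choose (apply A G o) s t A ≡ #circles G
      (λ e → if Vec.lookup A e then turnOf o (choose s t A e) else choose s t A e)
    relabelled G δ = #circles-relabel G A exchange exchange-involutive dualTurn exchange-flip (choose s t A)
    relabelled G τ = #circles-relabel G A twist twist-involutive petrialTurn twist-flip (choose s t A)

    chosen : turns ≗ choose (turnOf o s) t A
    chosen e with Vec.lookup A e
    ... | false = refl
    ... | true  = refl

  word-components : ∀ ρ G → #components (G ^ ρ ∣ A) ≡ #components G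
  word-components []      G = refl
  word-components (o ∷ ρ) G = trans (word-components ρ (apply A G o)) (apply-components G o)

  word-isolated : ∀ ρ G → RibbonGraph.isolated (G ^ ρ ∣ A) ≡ RibbonGraph.isolated G
  word-isolated []      G = refl
  word-isolated (o ∷ ρ) G = trans (word-isolated ρ (apply A G o)) (apply-isolated G o)

  -- The operation applied last acts on the turns first.
  word-choose : ∀ ρ G s t → #choose (G ^ ρ ∣ A) s t A ≡ #choose G (foldr turnOf s ρ) t A
  word-choose []      G s t = refl
  word-choose (o ∷ ρ) G s t = trans (word-choose ρ (apply A G o) s t) (apply-choose G o _ t)

  choose-same : ∀ t → (λ _ → t) ≗ choose t t A
  choose-same t e with Vec.lookup A e
  ... | false = refl
  ... | true  = refl

  word-vertices : ∀ ρ G → #vertices (G ^ ρ ∣ A) ≡ RibbonGraph.isolated G + #choose G (foldr turnOf end ρ) end A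
  word-vertices ρ G = trans (#vertices-circles (G ^ ρ ∣ A)) (cong₂ _+_ (word-isolated ρ G)
    (trans (#circles-cong (G ^ ρ ∣ A) (choose-same end)) (word-choose ρ G end end)))

  word-boundaries : ∀ ρ G → #boundaries (G ^ ρ ∣ A) ≡ RibbonGraph.isolated G + #choose G (foldr turnOf side ρ) side A
  word-boundaries ρ G = trans (#boundaries-circles (G ^ ρ ∣ A)) (cong₂ _+_ (word-isolated ρ G)
    (trans (#circles-cong (G ^ ρ ∣ A) (choose-same side)) (word-choose ρ G side side)))

-- Euler genus

-- The part of the vertex and boundary counts of `G ^ ρ ∣ A` that depends on `A`. For `δτ` the pairs
-- of turns (on, off `A`) are `side`, `end` and `diag`, `side`; for `δτδ` they are `diag`, `end` and
-- `side`, `side`.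
wordCost : List Operation → RibbonGraph n → Subset n → ℕ
wordCost ρ G A = #choose G (foldr turnOf end ρ) end A + #choose G (foldr turnOf side ρ) side A

eulerGenus-≡ : ∀ (G : RibbonGraph n) {k} i v f → #components G ≡ k →
  #vertices G ≡ i + v → #boundaries G ≡ i + f →
  eulerGenus G ≡ ℤ.+ (2 * k + n) ℤ.- ℤ.+ (2 * i + (v + f))
eulerGenus-≡ {n} G {k} i v f k≡ v≡ f≡ = begin
  eulerGenus G
    ≡⟨ cong₂ ℤ._-_ (cong₂ (λ a b → ℤ.+ (2 * a) ℤ.- ℤ.+ b ℤ.+ ℤ.+ n) k≡ v≡) (cong ℤ.+_ f≡) ⟩
  ℤ.+ (2 * k) ℤ.- ℤ.+ (i + v) ℤ.+ ℤ.+ n ℤ.- ℤ.+ (i + f)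
    ≡⟨ cong₂ (λ a b → ℤ.+ (2 * k) ℤ.- a ℤ.+ ℤ.+ n ℤ.- b) (ℤ.pos-+ i v) (ℤ.pos-+ i f) ⟩
  ℤ.+ (2 * k) ℤ.- (ℤ.+ i ℤ.+ ℤ.+ v) ℤ.+ ℤ.+ n ℤ.- (ℤ.+ i ℤ.+ ℤ.+ f)
    ≡⟨ regroup (ℤ.+ (2 * k)) (ℤ.+ i) (ℤ.+ v) (ℤ.+ n) (ℤ.+ f) ⟩
  ℤ.+ (2 * k) ℤ.+ ℤ.+ n ℤ.- (ℤ.+ 2 ℤ.* ℤ.+ i ℤ.+ (ℤ.+ v ℤ.+ ℤ.+ f))
    ≡⟨ cong₂ ℤ._-_ (ℤ.pos-+ (2 * k) n)
         (trans (ℤ.pos-+ (2 * i) (v + f)) (cong₂ ℤ._+_ (ℤ.pos-* 2 i) (ℤ.pos-+ v f))) ⟨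
  ℤ.+ (2 * k + n) ℤ.- ℤ.+ (2 * i + (v + f)) ∎
  where
  open ≡-Reasoning
  regroup : ∀ k i v n f → k ℤ.- (i ℤ.+ v) ℤ.+ n ℤ.- (i ℤ.+ f) ≡ k ℤ.+ n ℤ.- (ℤ.+ 2 ℤ.* i ℤ.+ (v ℤ.+ f))
  regroup = solve 5 (λ k i v n f →
    k :- (i :+ v) :+ n :- (i :+ f) := k :+ n :- (con (ℤ.+ 2) :* i :+ (v :+ f))) refl
    where open ℤ-Solver

eulerGenus-word : ∀ ρ (G : RibbonGraph n) A → eulerGenus (G ^ ρ ∣ A) ≡
  ℤ.+ (2 * #components G + n) ℤ.- ℤ.+ (2 * RibbonGraph.isolated G + wordCost ρ G A)
eulerGenus-word ρ G A = eulerGenus-≡ (G ^ ρ ∣ A) (RibbonGraph.isolated G)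
  (#choose G (foldr turnOf end ρ) end A) (#choose G (foldr turnOf side ρ) side A)
  (word-components A ρ G) (word-vertices A ρ G) (word-boundaries A ρ G)

eulerGenus-antitone : ∀ ρ (G : RibbonGraph n) {A B} → wordCost ρ G A ≤ wordCost ρ G B →
                      eulerGenus (G ^ ρ ∣ B) ℤ.≤ eulerGenus (G ^ ρ ∣ A)
eulerGenus-antitone {n} ρ G {A} {B} le = subst₂ ℤ._≤_ (sym (eulerGenus-word ρ G B)) (sym (eulerGenus-word ρ G A))
  (ℤ.+-monoʳ-≤ (ℤ.+ (2 * #components G + n)) (ℤ.neg-mono-≤ (ℤ.+≤+ (+-monoʳ-≤ (2 * RibbonGraph.isolated G) le))))

-- Attaining the maximum

∈-subsets : ∀ (B : Subset n) → B ∈ subsets n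
∈-subsets Vec.[]             = here refl
∈-subsets (false Vec.∷ B)    = ∈-++⁺ˡ (∈-map⁺ _ (∈-subsets B))
∈-subsets {suc n} (true Vec.∷ B) = ∈-++⁺ʳ (map (false Vec.∷_) (subsets n)) (∈-map⁺ _ (∈-subsets B))

max-attained : ∀ (f : A → ℤ) a xs → ∃ λ b → Extrema.max (f a) (map f xs) ≡ f b
max-attained f a xs with Extrema.argmax-sel id (f a) (map f xs)
-- The default is itself a value of `f`, so the maximum is attained in this case too.
... | inj₁ eq = a , eq
... | inj₂ p  = let (b , _ , eq) = ∈-map⁻ f p in b , eq

maximiser : ∀ {P : A → Set} (f : A → ℤ) a xs → (∀ b → b ∈ xs) →
            (∀ b → ∃ λ c → P c × f b ℤ.≤ f c) → ∃ λ c → P c × f c ≡ Extrema.max (f a) (map f xs)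
maximiser f a xs complete improve =
  let (b , attained) = max-attained f a xs
      (c , p , le)   = improve b
  in c , p , ℤ.≤-antisym (All.lookup (Extrema.xs≤max (f a) (map f xs)) (∈-map⁺ f (complete c)))
                         (ℤ.≤-trans (ℤ.≤-reflexive attained) le)

quasiTree-max : ∀ ρ (G : RibbonGraph n) →
  (∀ B → ∃ λ Q → Quasi G Q × wordCost ρ G Q ≤ wordCost ρ G B) →
  ∃ λ Q → IsSpanningQuasiTree G Q × eulerGenus (G ^ ρ ∣ Q) ≡ maxEulerGenus ρ G
quasiTree-max {n} ρ G cheaper =
  maximiser (λ B → eulerGenus (G ^ ρ ∣ B)) ⊥ (subsets n) ∈-subsets λ B →
    let (Q , quasi , le) = cheaper B
    in Q , quasi⇒quasiTree G quasi , eulerGenus-antitone ρ G {Q} {B} le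

corollary5p2 : ∀ {n : ℕ} (G : RibbonGraph n) (ρ : List Operation) →
    ρ ≡ δτ ⊎ ρ ≡ δτδ →
    ∃ λ (Q : Subset n) → IsSpanningQuasiTree G Q ×
    eulerGenus (G ^ ρ ∣ Q) ≡ maxEulerGenus ρ G
corollary5p2 G .δτ (inj₁ refl) =
  quasiTree-max δτ G (descend (Quasi G) (#choose G side end) (wordCost δτ G) (improve-δτ G))
corollary5p2 G .δτδ (inj₂ refl) = quasiTree-max δτδ G λ B →
  let (Q , quasi , le) = descend (Quasi G) (weight G) (#choose G diag end) (improve-δτδ G) B
  -- The second summand of the cost for `δτδ` turns along `side` at every edge, so it is the same
  -- for `Q` and `B`.
  in Q , quasi , +-mono-≤ le (≤-reflexive (#circles-cong G
       (λ e → trans (sym (choose-same Q side e)) (choose-same B side e))))
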